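{- Let $G$ be a 2-connected bipartite graph without pairs of twins. Then $\ell_2(G)\geq |V(G)|$.
   Context: Graphs are finite and simple; a graph is 2-connected if it is connected, has at least three vertices and has no cut vertex. $d$ denotes the shortest-path distance. For distinct vertices $x,y$, $\overline{xy}^G=\{z\in V(G): d(x,y)=d(x,z)+d(z,y)\ \text{or}\ d(x,y)=|d(x,z)-d(z,y)|\}$. $\ell_2(G)$ is the number of distinct sets $\overline{xy}^G$ over all pairs $x,y$ with $d(x,y)=2$. A pair of twins is a pair $(v,v')$ of distinct vertices with $d(v,v')\neq 1$ and $d(v,u)=d(v',u)$ for every vertex $u\notin\{v,v'\}$. -}

module Defs where

open import Data.Nat using (ℕ; zero; suc; _+_; _≤_; ∣_-_∣)
open import Data.Nat.Properties using () renaming (_≟_ to _≟ℕ_)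
open import Data.Bool using (Bool; true; false; _∧_; _∨_; if_then_else_)
open import Data.Bool.Properties using () renaming (_≟_ to _≟B_)
open import Data.Fin using (Fin)
open import Data.Fin.Subset using (Subset; ⁅_⁆; _∪_)
open import Data.Vec using (lookup; tabulate)
open import Data.Vec.Properties using (≡-dec)
open import Data.List using (List; length; map; filter; deduplicate; cartesianProduct; allFin)
open import Data.Bool.ListAction using (any)
open import Data.Product using (_×_; _,_; ∃; proj₁; proj₂)
open import Relation.Binary.PropositionalEquality using (_≡_; _≢_)
open import Relation.Nullary.Decidable using (⌊_⌋)
open import Data.Empty using (⊥)

record Graph (n : ℕ) : Set where
  field
    adj     : Fin n → Fin n → Bool
    adj-sym : ∀ x y → adj x y ≡ adj y x
    irrefl  : ∀ x → adj x x ≡ false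

module _ {n : ℕ} (G : Graph n) where
  open Graph G

  data Walk : Fin n → Fin n → Set where
    here : ∀ {x} → Walk x x
    step : ∀ {x y z} → adj x y ≡ true → Walk y z → Walk x z

  data WalkAvoiding (v : Fin n) : Fin n → Fin n → Set where
    here : ∀ {x} → x ≢ v → WalkAvoiding v x x
    step : ∀ {x y z} → x ≢ v → adj x y ≡ true → WalkAvoiding v y z → WalkAvoiding v x z

  Connected : Set
  Connected = ∀ x y → Walk x y

  NoCutVertex : Set
  NoCutVertex = ∀ v x y → x ≢ v → y ≢ v → WalkAvoiding v x y

  TwoConnected : Set
  TwoConnected = Connected × 3 ≤ n × NoCutVertex

  Bipartite : Set
  Bipartite = ∃ λ (c : Fin n → Bool) → ∀ x y → adj x y ≡ true → c x ≢ c y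

  nbr : Subset n → Subset n
  nbr S = tabulate λ y → any (λ z → lookup S z ∧ adj z y) (allFin n)

  ball : ℕ → Fin n → Subset n
  ball zero    x = ⁅ x ⁆
  ball (suc k) x = ball k x ∪ nbr (ball k x)

  search : (ℕ → Bool) → ℕ → ℕ → ℕ
  search p k zero       = k
  search p k (suc fuel) = if p k then k else search p (suc k) fuel

  -- shortest-path distance d(x,y): least k ≤ n with y ∈ ball k x
  -- (correct for connected graphs, where d(x,y) ≤ n - 1)
  dist : Fin n → Fin n → ℕ
  dist x y = search (λ k → lookup (ball k x) y) 0 n

  interval : Fin n → Fin n → Subset n
  interval x y = tabulate λ z →
    ⌊ dist x y ≟ℕ dist x z + dist z y ⌋ ∨ ⌊ dist x y ≟ℕ ∣ dist x z - dist z y ∣ ⌋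

  ℓ₂ : ℕ
  ℓ₂ = length (deduplicate (≡-dec _≟B_)
         (map (λ p → interval (proj₁ p) (proj₂ p))
           (filter (λ p → dist (proj₁ p) (proj₂ p) ≟ℕ 2)
             (cartesianProduct (allFin n) (allFin n)))))

  Twins : Fin n → Fin n → Set
  Twins v v' = v ≢ v' × dist v v' ≢ 1 × (∀ u → u ≢ v → u ≢ v' → dist v u ≡ dist v' u)

  NoTwins : Set
  NoTwins = ∀ v v' → Twins v v' → ⊥

-- If d x y = 2, the line of x and y misses exactly the vertices u with d u x = d u y ≠ 1. Comparing the four
-- distances between two pairs that generate the same line shows that the pairs lie in the order y, x, z, w on a
-- geodesic. Since y is not a cut vertex, every neighbour of y is then a neighbour of x: otherwise a walk from such
-- a neighbour to w that avoids y would stay among the vertices u with d u x = d u y + 2 and d u w = d u z + 2.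
-- Call y a tail and x its head. No tail is a head, so a pair without such an orientation ("good") is the only
-- one that generates its line.
-- The vertices are matched with lines one colour class at a time. Non-tails span an isometric subgraph, so in the
-- distance-two graph a non-tail forms a good pair with a parent closer to a root. A tail forms a good pair with
-- a non-tail, or with two tails, and then receives a half of each. Each root receives one additional pair.
-- Halves are made countable by giving every vertex two ordered pairs.

{-# OPTIONS --safe #-}
module Submission where

open import Defs
open import Data.Bool using (Bool; true; false; not; T; _∧_; _∨_; if_then_else_)
open import Data.Bool.Properties using (T-≡; T-∧; ∨-zeroʳ; ¬-not; not-involutive) renaming (_≟_ to _≟ᵇ_)
open import Data.Empty using (⊥; ⊥-elim)
open import Data.Fin using (Fin; zero; suc; combine; remQuot; toℕ)
open import Data.Fin.Properties using (any?; combine-injective; combine-remQuot; injective⇒≤; toℕ-injective) renaming (_≟_ to _≟ᶠ_)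
open import Data.Fin.Subset using (Subset; _∈_; ∣_∣)
open import Data.Fin.Subset.Properties
  using (x∈⁅x⁆; x∈⁅y⁆⇒x≡y; x∈p∪q⁻; p⊆p∪q; q⊆p∪q; _∈?_; p⊂q⇒∣p∣<∣q∣; ∣p∣≤n; ∣⁅x⁆∣≡1)
open import Data.List using (List; length; map; filter; deduplicate; cartesianProduct; allFin) renaming (lookup to lookupᴸ)
open import Data.List.Membership.Propositional using (lose) renaming (_∈_ to _∈ᴸ_)
open import Data.List.Membership.Propositional.Properties using (∈-allFin; ∈-map⁺; ∈-filter⁺; ∈-cartesianProduct⁺; ∈-deduplicate⁺)
open import Data.List.Relation.Unary.Any using (satisfied; index)
open import Data.List.Relation.Unary.Any.Properties using (any⁺; any⁻; lookup-index)
open import Data.Nat using (ℕ; zero; suc; _+_; _*_; _≤_; _<_; _<?_; z≤n; s≤s; ∣_-_∣)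
open import Data.Nat.Properties using
  ( ≤-refl; ≤-trans; ≤-reflexive; ≤-antisym; ≤-total; ≤-pred; <⇒≱; <⇒≯; <-irrefl; ≮⇒≥; *-cancelʳ-≤; ≤∧≢⇒<; +-comm; +-suc; m≤n⇒m≤1+n
  ; n≤0⇒n≡0; m≢1+n+m; ∣-∣-comm; ∣n-n∣≡0; ∣m-m+n∣≡n; suc-injective; n≤1+n; +-monoˡ-≤)
  renaming (_≟_ to _≟ℕ_)
open import Data.Product using (_×_; _,_; ∃; ∃₂; proj₁; proj₂)
open import Data.Sum using (_⊎_; inj₁; inj₂; [_,_]′)
open import Data.Vec using (lookup)
open import Data.Vec.Properties using (lookup∘tabulate; tabulate-cong; []=⇒lookup; lookup⇒[]=; ≡-dec)
open import Function using (_∘_; case_of_)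
open import Function.Bundles using (Equivalence)
open import Relation.Binary.PropositionalEquality
  using (_≡_; _≢_; refl; sym; trans; cong; cong₂; subst; subst₂; module ≡-Reasoning)
open import Relation.Nullary using (¬_; Dec; yes; no; contradiction)
open import Relation.Nullary.Decidable using (⌊_⌋; _×-dec_; ¬?; map′; does; dec-true; dec-false)

-- The search behind `dist`, and the arithmetic of neighbouring distances.

search-least : ∀ {n} (G : Graph n) (p : ℕ → Bool) k fuel {j} →
  k ≤ j → p j ≡ true → search G p k fuel ≤ j
search-least G p k zero       k≤j pj = k≤j
search-least G p k (suc fuel) {j} k≤j pj with p k in pk
... | true  = k≤j
... | false = search-least G p (suc k) fuel (≤∧≢⇒< k≤j k≢j) pj
  where
  k≢j : k ≢ j
  k≢j refl with () ← trans (sym pk) pj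

search-sound : ∀ {n} (G : Graph n) (p : ℕ → Bool) k fuel →
  p (k + fuel) ≡ true → p (search G p k fuel) ≡ true
search-sound G p k zero       ph = trans (cong p (+-comm 0 k)) ph
search-sound G p k (suc fuel) ph with p k in pk
... | true  = pk
... | false = search-sound G p (suc k) fuel (trans (cong p (sym (+-suc k fuel))) ph)

-- In a bipartite graph `Near` relates the distances from a fixed vertex to two adjacent vertices,
-- and `Gap` those to two vertices at distance two.
Near : ℕ → ℕ → Set
Near i j = j ≡ suc i ⊎ i ≡ suc j

Gap : ℕ → ℕ → Set
Gap i j = i ≡ j ⊎ j ≡ 2 + i ⊎ i ≡ 2 + j

near-≤ : ∀ {i j} → Near i j → i ≤ suc j
near-≤ (inj₁ refl) = ≤-trans (n≤1+n _) (n≤1+n _)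
near-≤ (inj₂ refl) = ≤-refl

gap-sym : ∀ {i j} → Gap i j → Gap j i
gap-sym (inj₁ e)        = inj₁ (sym e)
gap-sym (inj₂ (inj₁ e)) = inj₂ (inj₂ e)
gap-sym (inj₂ (inj₂ e)) = inj₂ (inj₁ e)

near-near : ∀ {h i j} → Near h i → Near h j → Gap i j
near-near (inj₁ refl) (inj₁ refl) = inj₁ refl
near-near (inj₁ refl) (inj₂ refl) = inj₂ (inj₂ refl)
near-near (inj₂ refl) (inj₁ refl) = inj₂ (inj₁ refl)
near-near (inj₂ refl) (inj₂ refl) = inj₁ refl

-- Shortest-path distance as a metric.

module Distance {n : ℕ} (G : Graph n) (connected : Connected G) where
  open Graph G public

  infix 4 _~_
  _~_ : Fin n → Fin n → Set
  x ~ y = adj x y ≡ true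

  ~-sym : ∀ {x y} → x ~ y → y ~ x
  ~-sym {x} {y} e = trans (adj-sym y x) e

  ~⇒≢ : ∀ {x y} → x ~ y → x ≢ y
  ~⇒≢ {x} e refl with () ← trans (sym e) (irrefl x)

  opaque
    -- Opaque, to keep the type checker from unfolding the search.
    d : Fin n → Fin n → ℕ
    d = dist G

    d≡dist : ∀ x y → d x y ≡ dist G x y
    d≡dist x y = refl

  ∈nbr⁺ : ∀ {S y z} → z ∈ S → z ~ y → y ∈ nbr G S
  ∈nbr⁺ {S} {y} {z} z∈S z~y = lookup⇒[]= y _ (trans (lookup∘tabulate _ y)
    (Equivalence.to T-≡ (any⁺ _ (lose (∈-allFin z)
      (Equivalence.from T-≡ (cong₂ _∧_ ([]=⇒lookup z∈S) z~y))))))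

  ∈nbr⁻ : ∀ {S y} → y ∈ nbr G S → ∃ λ z → z ∈ S × z ~ y
  ∈nbr⁻ {S} {y} y∈ with satisfied (any⁻ _ (allFin n)
         (Equivalence.from T-≡ (trans (sym (lookup∘tabulate _ y)) ([]=⇒lookup y∈))))
  ... | z , t with Equivalence.to T-∧ t
  ... | t₁ , t₂ = z , lookup⇒[]= z S (Equivalence.to T-≡ t₁) , Equivalence.to T-≡ t₂

  ball-mono : ∀ k {x y} → y ∈ ball G k x → y ∈ ball G (suc k) x
  ball-mono k = p⊆p∪q _

  ball-last : ∀ k {x y z} → y ∈ ball G k x → y ~ z → z ∈ ball G (suc k) x
  ball-last k y∈ y~z = q⊆p∪q _ _ (∈nbr⁺ y∈ y~z)

  ball-suc⁻ : ∀ k {x y} → y ∈ ball G (suc k) x →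
    y ∈ ball G k x ⊎ (∃ λ z → z ∈ ball G k x × z ~ y)
  ball-suc⁻ k y∈ with x∈p∪q⁻ _ _ y∈
  ... | inj₁ q = inj₁ q
  ... | inj₂ q = inj₂ (∈nbr⁻ q)

  ball-first : ∀ k {x y z} → x ~ y → z ∈ ball G k y → z ∈ ball G (suc k) x
  ball-first zero {x} x~y z∈ with refl ← x∈⁅y⁆⇒x≡y _ z∈ = ball-last zero (x∈⁅x⁆ x) x~y
  ball-first (suc k) x~y z∈ with ball-suc⁻ k z∈
  ... | inj₁ q            = ball-mono (suc k) (ball-first k x~y q)
  ... | inj₂ (v , q , v~) = ball-last (suc k) (ball-first k x~y q) v~

  ball-sym : ∀ k {x y} → y ∈ ball G k x → x ∈ ball G k y
  ball-sym zero {x} y∈ with refl ← x∈⁅y⁆⇒x≡y _ y∈ = x∈⁅x⁆ x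
  ball-sym (suc k) y∈ with ball-suc⁻ k y∈
  ... | inj₁ q            = ball-mono k (ball-sym k q)
  ... | inj₂ (v , q , v~) = ball-first k (~-sym v~) (ball-sym k q)

  -- A ball that gains no vertex in one step is closed under adjacency, hence is everything by
  -- connectedness. So radius `n` suffices, which justifies the cutoff of the search.
  ball-large : ∀ x k → suc k ≤ ∣ ball G k x ∣ ⊎ (∀ y → y ∈ ball G k x)
  ball-large x zero = inj₁ (≤-reflexive (sym (∣⁅x⁆∣≡1 x)))
  ball-large x (suc k) with ball-large x k
  ... | inj₂ full = inj₂ (ball-mono k ∘ full)
  ... | inj₁ large
    with any? (λ y → (y ∈? ball G (suc k) x) ×-dec ¬? (y ∈? ball G k x))
  ... | yes (y , y∈ , y∉) = inj₁ (≤-trans (s≤s large) (p⊂q⇒∣p∣<∣q∣ (ball-mono k , y , y∈ , y∉)))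
  ... | no none = inj₂ λ y → ball-mono k (closed (connected x y) (centre k))
    where
    centre : ∀ j → x ∈ ball G j x
    centre zero    = x∈⁅x⁆ x
    centre (suc j) = ball-mono j (centre j)
    closed : ∀ {u v} → Walk G u v → u ∈ ball G k x → v ∈ ball G k x
    closed here u∈ = u∈
    closed (step {y = u′} u~u′ walk) u∈ with u′ ∈? ball G k x
    ... | yes q = closed walk q
    ... | no ¬q = contradiction (u′ , ball-last k u∈ u~u′ , ¬q) none

  ball-full : ∀ x y → y ∈ ball G n x
  ball-full x y with ball-large x n
  ... | inj₁ large = contradiction (∣p∣≤n (ball G n x)) (<⇒≱ large)
  ... | inj₂ full  = full y

  opaque
    unfolding d

    d-ball : ∀ x y → y ∈ ball G (d x y) x
    d-ball x y = lookup⇒[]= y _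
      (search-sound G (λ k → lookup (ball G k x) y) 0 n ([]=⇒lookup (ball-full x y)))

    d-least : ∀ {x y} k → y ∈ ball G k x → d x y ≤ k
    d-least {x} {y} k y∈ = search-least G (λ k → lookup (ball G k x) y) 0 n z≤n ([]=⇒lookup y∈)

  d-sym : ∀ x y → d x y ≡ d y x
  d-sym x y = ≤-antisym (d-least _ (ball-sym (d y x) (d-ball y x)))
                      (d-least _ (ball-sym (d x y) (d-ball x y)))

  d-refl : ∀ x → d x x ≡ 0
  d-refl x = n≤0⇒n≡0 (d-least 0 (x∈⁅x⁆ x))

  d≡0⇒≡ : ∀ {x y} → d x y ≡ 0 → x ≡ y
  d≡0⇒≡ {x} {y} e = sym (x∈⁅y⁆⇒x≡y _ (subst (λ k → y ∈ ball G k x) e (d-ball x y)))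

  d-step : ∀ {u v} t → u ~ v → d u t ≤ suc (d v t)
  d-step {u} {v} t u~v = d-least _ (ball-first (d v t) u~v (d-ball v t))

  -- The first edge of a geodesic: `u` enters the balls around `t` at radius `suc k`, through a
  -- neighbour in the ball of radius `k`.
  d-first : ∀ {u t k} → d u t ≡ suc k → ∃ λ v → u ~ v × d v t ≡ k
  d-first {u} {t} {k} e
    with ball-suc⁻ k (subst (λ j → u ∈ ball G j t) (trans (d-sym t u) e) (d-ball t u))
  ... | inj₁ q = contradiction
    (≤-trans (≤-reflexive (sym e)) (≤-trans (≤-reflexive (d-sym u t)) (d-least k q))) (<⇒≱ ≤-refl)
  ... | inj₂ (v , q , v~u) = v , ~-sym v~u ,
    ≤-antisym (≤-trans (≤-reflexive (d-sym v t)) (d-least k q))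
              (≤-pred (≤-trans (≤-reflexive (sym e)) (d-step t (~-sym v~u))))

  d≢0 : ∀ {x y} → x ≢ y → ∃ λ k → d x y ≡ suc k
  d≢0 {x} {y} x≢y with d x y in e
  ... | zero  = contradiction (d≡0⇒≡ e) x≢y
  ... | suc k = k , refl

  ~⇒d≡1 : ∀ {x y} → x ~ y → d x y ≡ 1
  ~⇒d≡1 {x} {y} x~y = ≤-antisym (≤-trans (d-step y x~y) (s≤s (≤-reflexive (d-refl y))))
    (≤-trans (s≤s z≤n) (≤-reflexive (sym (proj₂ (d≢0 (~⇒≢ x~y))))))

  d≡1⇒~ : ∀ {x y} → d x y ≡ 1 → x ~ y
  d≡1⇒~ {x} e with v , x~v , e′ ← d-first e = subst (x ~_) (d≡0⇒≡ e′) x~v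

  d-triangle : ∀ x y z → d x z ≤ d x y + d y z
  d-triangle x y z = go (d x y) refl
    where
    go : ∀ k {x} → d x y ≡ k → d x z ≤ k + d y z
    go zero    e = ≤-reflexive (cong (λ v → d v z) (d≡0⇒≡ e))
    go (suc k) e with v , x~v , e′ ← d-first e = ≤-trans (d-step z x~v) (s≤s (go k e′))

-- Parity of distances, and lines of pairs at distance two.

alternate : ℕ → Bool → Bool
alternate zero    b = b
alternate (suc k) b = not (alternate k b)

near-intro : ∀ {i j} → i ≤ suc j → j ≤ suc i → i ≢ j → Near i j
near-intro {i} {j} i≤ j≤ i≢j with ≤-total i j
... | inj₁ i≤j = inj₁ (≤-antisym j≤ (≤∧≢⇒< i≤j i≢j))
... | inj₂ j≤i = inj₂ (≤-antisym i≤ (≤∧≢⇒< j≤i (i≢j ∘ sym)))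

near-between : ∀ {b k} → Near b k → Near (2 + b) k → k ≡ suc b
near-between (inj₁ e)    _ = e
near-between (inj₂ refl) (inj₁ ())
near-between (inj₂ refl) (inj₂ ())

near-1 : ∀ {k} → Near 1 k → k ≢ 0 → k ≡ 2
near-1 (inj₁ e)    _   = e
near-1 (inj₂ refl) k≢0 = contradiction refl k≢0

-- The membership test of `interval` for a pair at distance two, in terms of the distances from a
-- vertex to its ends.
hit : ℕ → ℕ → Bool
hit i j = ⌊ 2 ≟ℕ i + j ⌋ ∨ ⌊ 2 ≟ℕ ∣ i - j ∣ ⌋

hit-≡ : ∀ i → i ≢ 1 → hit i i ≡ false
hit-≡ 0 _ = refl
hit-≡ 1 i≢1 = contradiction refl i≢1
hit-≡ (suc (suc k)) _ rewrite +-suc k (suc k) | ∣n-n∣≡0 k = refl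

∣i-2+i∣≡2 : ∀ i → ∣ i - (2 + i) ∣ ≡ 2
∣i-2+i∣≡2 i = trans (cong ∣ i -_∣ (+-comm 2 i)) (∣m-m+n∣≡n i 2)

-- Distances that differ by two pass the difference test; distances both equal to one pass the sum
-- test.
hit-false⁻ : ∀ {i j} → Gap i j → hit i j ≡ false → i ≡ j × i ≢ 1
hit-false⁻ (inj₁ refl) e = refl , λ { refl → case e of λ () }
hit-false⁻ {i} (inj₂ (inj₁ refl)) e
  rewrite ∣i-2+i∣≡2 i = case trans (sym e) (∨-zeroʳ ⌊ 2 ≟ℕ i + (2 + i) ⌋) of λ ()
hit-false⁻ {j = j} (inj₂ (inj₂ refl)) e
  rewrite ∣-∣-comm (2 + j) j | ∣i-2+i∣≡2 j = case trans (sym e) (∨-zeroʳ ⌊ 2 ≟ℕ (2 + j) + j ⌋) of λ ()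

module Bipartition {n : ℕ} (G : Graph n) (connected : Connected G)
    (c : Fin n → Bool) (proper : ∀ x y → Graph.adj G x y ≡ true → c x ≢ c y) where
  open Distance G connected public

  colour-alternates : ∀ k {u t} → d u t ≡ k → c u ≡ alternate k (c t)
  colour-alternates zero e = cong c (d≡0⇒≡ e)
  colour-alternates (suc k) e with v , u~v , e′ ← d-first e =
    trans (¬-not (proper _ _ u~v)) (cong not (colour-alternates k e′))

  near : ∀ {u v} → u ~ v → ∀ t → Near (d u t) (d v t)
  near {u} {v} u~v t = near-intro (d-step t u~v) (d-step t (~-sym u~v))
    λ e → proper u v u~v (trans (colour-alternates _ e) (sym (colour-alternates _ refl)))

  near′ : ∀ {u v} → u ~ v → ∀ t → Near (d t u) (d t v)
  near′ {u} {v} u~v t = subst₂ Near (d-sym u t) (d-sym v t) (near u~v t)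

  colour-2 : ∀ {u v} → d u v ≡ 2 → c u ≡ c v
  colour-2 {u} {v} e = trans (colour-alternates 2 e) (not-involutive (c v))

  midpoint : ∀ {x y} → d x y ≡ 2 → ∃ λ p → x ~ p × y ~ p
  midpoint e with p , x~p , e′ ← d-first e = p , x~p , ~-sym (d≡1⇒~ e′)

  ~-~⇒2 : ∀ {x y p} → x ~ p → y ~ p → x ≢ y → d x y ≡ 2
  ~-~⇒2 {x} {y} x~p y~p x≢y =
    near-1 (subst (λ k → Near k (d x y)) (~⇒d≡1 x~p) (near′ (~-sym y~p) x)) (x≢y ∘ d≡0⇒≡)

  gap : ∀ {x y} → d x y ≡ 2 → ∀ u → Gap (d u x) (d u y)
  gap e u with p , x~p , y~p ← midpoint e = near-near (near′ (~-sym x~p) u) (near′ (~-sym y~p) u)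

  Omit : Fin n → Fin n → Fin n → Set
  Omit x y u = d u x ≡ d u y × d u x ≢ 1

  opaque
    unfolding d

    line : Fin n → Fin n → Subset n
    line = interval G

    line≡interval : ∀ x y → line x y ≡ interval G x y
    line≡interval x y = refl

    line-sym : ∀ x y → line x y ≡ line y x
    line-sym x y = tabulate-cong λ z → cong₂ _∨_
      (cong₂ (λ i j → ⌊ i ≟ℕ j ⌋) (d-sym x y) (trans (+-comm (d x z) (d z y)) (cong₂ _+_ (d-sym z y) (d-sym x z))))
      (cong₂ (λ i j → ⌊ i ≟ℕ j ⌋) (d-sym x y) (trans (∣-∣-comm (d x z) (d z y)) (cong₂ ∣_-_∣ (d-sym z y) (d-sym x z))))

    lookup-line : ∀ {x y} → d x y ≡ 2 → ∀ u → lookup (line x y) u ≡ hit (d u x) (d u y)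
    lookup-line {x} {y} e u = trans (lookup∘tabulate _ u)
      (cong₂ (λ i j → ⌊ i ≟ℕ j + d u y ⌋ ∨ ⌊ i ≟ℕ ∣ j - d u y ∣ ⌋) e (d-sym x u))

  -- Equality of lines enters the distance arguments only in this form.
  omit-transfer : ∀ {x y z w} → d x y ≡ 2 → d z w ≡ 2 → line x y ≡ line z w →
    ∀ {u} → Omit x y u → Omit z w u
  omit-transfer {x} {y} {z} {w} xy zw eq {u} (e , ≢1) = hit-false⁻ (gap zw u) (begin
    hit (d u z) (d u w)  ≡⟨ sym (lookup-line zw u) ⟩
    lookup (line z w) u  ≡⟨ cong (λ l → lookup l u) (sym eq) ⟩
    lookup (line x y) u  ≡⟨ lookup-line xy u ⟩
    hit (d u x) (d u y)  ≡⟨ cong (hit (d u x)) (sym e) ⟩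
    hit (d u x) (d u x)  ≡⟨ hit-≡ (d u x) ≢1 ⟩
    false                ∎)
    where open ≡-Reasoning

-- Aligned pairs, and domination of a tail by its head.

cyclic : ∀ {A : Set} j {k} → k ≡ suc (j + k) → A
cyclic j e = contradiction e (m≢1+n+m _)

near-3 : ∀ {k} → ¬ Near k (3 + k)
near-3 (inj₁ ())
near-3 (inj₂ ())

-- With `i` and `2 + i` the distances from a vertex to the ends of a pair, a step to a neighbour
-- keeps the difference or closes it; `Gap` excludes a difference of four.
south-next : ∀ {i i′ j′} → Near i i′ → Near (2 + i) j′ → Gap i′ j′ →
  j′ ≡ 2 + i′ ⊎ (i′ ≡ suc i × j′ ≡ suc i)
south-next (inj₁ refl) (inj₁ refl) _ = inj₁ refl
south-next (inj₁ refl) (inj₂ refl) _ = inj₂ (refl , refl)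
south-next (inj₂ refl) (inj₂ refl) _ = inj₁ refl
south-next (inj₂ refl) (inj₁ refl) (inj₁ ())
south-next (inj₂ refl) (inj₁ refl) (inj₂ (inj₁ ()))
south-next (inj₂ refl) (inj₁ refl) (inj₂ (inj₂ ()))

south-closer : ∀ {k j′} → Near (3 + k) j′ → Gap k j′ → j′ ≡ 2 + k
south-closer (inj₂ refl) _ = refl
south-closer (inj₁ refl) (inj₁ ())
south-closer (inj₁ refl) (inj₂ (inj₁ ()))
south-closer (inj₁ refl) (inj₂ (inj₂ ()))

south-start : ∀ {b i j} → Near (2 + b) i → Near (4 + b) j → j ≡ 2 + i ⊎ i ≡ j ⊎ (i ≡ 1 + b × j ≡ 5 + b)
south-start (inj₁ refl) (inj₁ refl) = inj₁ refl
south-start (inj₁ refl) (inj₂ refl) = inj₂ (inj₁ refl)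
south-start (inj₂ refl) (inj₁ refl) = inj₂ (inj₂ (refl , refl))
south-start (inj₂ refl) (inj₂ refl) = inj₁ refl

gap-1 : ∀ {j} → Gap 1 j → j ≡ 1 ⊎ j ≡ 3
gap-1 (inj₁ refl)        = inj₁ refl
gap-1 (inj₂ (inj₁ refl)) = inj₂ refl

gap-4 : ∀ {b} → ¬ Gap b (4 + b)
gap-4 (inj₁ ())
gap-4 (inj₂ (inj₁ ()))
gap-4 (inj₂ (inj₂ ()))

third : ∀ {n} → 3 ≤ n → (a b : Fin n) → ∃ λ v → v ≢ a × v ≢ b
third (s≤s (s≤s (s≤s _))) zero          zero          = suc zero       , (λ ()) , λ ()
third (s≤s (s≤s (s≤s _))) zero          (suc zero)    = suc (suc zero) , (λ ()) , λ ()
third (s≤s (s≤s (s≤s _))) zero          (suc (suc _)) = suc zero       , (λ ()) , λ ()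
third (s≤s (s≤s (s≤s _))) (suc zero)    zero          = suc (suc zero) , (λ ()) , λ ()
third (s≤s (s≤s (s≤s _))) (suc (suc _)) zero          = suc zero       , (λ ()) , λ ()
third (s≤s (s≤s (s≤s _))) (suc _)       (suc _)       = zero           , (λ ()) , λ ()

module Lines {n : ℕ} (G : Graph n) (connected : Connected G) (3≤n : 3 ≤ n)
    (noCut : NoCutVertex G)
    (c : Fin n → Bool) (proper : ∀ x y → Graph.adj G x y ≡ true → c x ≢ c y)
    (noTwins : NoTwins G) where
  open Bipartition G connected c proper public

  -- Two pairs at distance two lying in the order y, x, z, w on a geodesic
  -- (x and z may coincide) and generating the same line.
  record Aligned (y x w z : Fin n) : Set where
    constructor aligned
    field
      yx   : d y x ≡ 2
      wz   : d w z ≡ 2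
      yz   : d y z ≡ 2 + d x z
      xw   : d x w ≡ 2 + d x z
      yw   : d y w ≡ 4 + d x z
      same : line y x ≡ line w z

  aligned? : ∀ y x w z → Dec (Aligned y x w z)
  aligned? y x w z = map′
    (λ { (yx , wz , yz , xw , yw , same) → aligned yx wz yz xw yw same })
    (λ { (aligned yx wz yz xw yw same) → yx , wz , yz , xw , yw , same })
    (d y x ≟ℕ 2 ×-dec d w z ≟ℕ 2 ×-dec d y z ≟ℕ 2 + d x z ×-dec d x w ≟ℕ 2 + d x z
      ×-dec d y w ≟ℕ 4 + d x z ×-dec ≡-dec _≟ᵇ_ (line y x) (line w z))

  aligned-sym : ∀ {y x w z} → Aligned y x w z → Aligned w z y x
  aligned-sym {y} {x} {w} {z} (aligned yx wz yz xw yw same) = aligned wz yx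
    (trans (d-sym w x) (trans xw (cong (2 +_) (d-sym x z))))
    (trans (d-sym z y) (trans yz (cong (2 +_) (d-sym x z))))
    (trans (d-sym w y) (trans yw (cong (4 +_) (d-sym x z))))
    (sym same)

  module _ {y x w z} (L : Aligned y x w z) where
    open Aligned L

    private
      a : ℕ
      a = d x z

      South : Fin n → Set
      South u = d u x ≡ 2 + d u y × d u w ≡ 2 + d u z

      omit⇒ : ∀ {u} → Omit y x u → Omit w z u
      omit⇒ = omit-transfer yx wz same

      omit⇐ : ∀ {u} → Omit w z u → Omit y x u
      omit⇐ = omit-transfer wz yx (sym same)

      z-not-south : ¬ South z
      z-not-south (e , _) = cyclic 3 (trans (d-sym x z) (trans e (cong (2 +_) (trans (d-sym z y) yz))))

      -- A geodesic from `u` to `z` can leave `South` only through `y`: any other exit is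
      -- equidistant from `y` and `x` but not adjacent to them, so the common line misses it,
      -- although `w` is still two farther than `z`. The summand `2 + a` is `d y z`.
      south-far : ∀ k {u} → d u z ≡ k → South u → d u y + (2 + a) ≤ k
      south-far zero e s with refl ← d≡0⇒≡ e = ⊥-elim (z-not-south s)
      south-far (suc k) {u} e (ux , uw)
        with v , u~v , vz ← d-first e
        with vw ← south-closer (subst (λ j → Near j (d v w)) (trans uw (cong (2 +_) e)) (near u~v w))
                    (subst (λ j → Gap j (d v w)) vz (gap-sym (gap wz v)))
        with south-next (near u~v y) (subst (λ j → Near j (d v x)) ux (near u~v x)) (gap yx v)
      ... | inj₁ vx = ≤-trans (+-monoˡ-≤ (2 + a) (near-≤ (near u~v y)))
              (s≤s (south-far k vz (vx , trans vw (cong (2 +_) (sym vz)))))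
      ... | inj₂ (vy , vx) with d v y ≟ℕ 1
      ...   | yes vy≡1 with refl ← d≡0⇒≡ {u} {y} (suc-injective (trans (sym vy) vy≡1)) =
              ≤-reflexive (trans (cong (_+ (2 + a)) (d-refl y)) (trans (sym yz) e))
      ...   | no vy≢1 with () ← trans (sym vz) (trans (sym (proj₁ (omit⇒ (trans vy (sym vx) , vy≢1)))) vw)

      -- A neighbour outside `South` is equidistant from the ends of one pair. If it is adjacent to
      -- them, `u` is `y` or `z`; otherwise it is missed, so both differences close at once.
      south-step : ∀ {u v} → u ~ v → u ≢ y → South u → South v
      south-step {u} {v} u~v u≢y (ux , uw)
        with south-next (near u~v y) (subst (λ j → Near j (d v x)) ux (near u~v x)) (gap yx v)
           | south-next (near u~v z) (subst (λ j → Near j (d v w)) uw (near u~v w)) (gap-sym (gap wz v))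
      ... | inj₁ vx | inj₁ vw = vx , vw
      ... | inj₁ vx | inj₂ (vz , vw) with d v w ≟ℕ 1
      ...   | yes vw≡1 with refl ← d≡0⇒≡ {u} {z} (suc-injective (trans (sym vw) vw≡1)) = ⊥-elim (z-not-south (ux , uw))
      ...   | no vw≢1 = cyclic 1 (trans (proj₁ (omit⇐ (trans vw (sym vz) , vw≢1))) vx)
      south-step {u} {v} u~v u≢y (ux , uw) | inj₂ (vy , vx) | q with d v y ≟ℕ 1
      ...   | yes vy≡1 = contradiction (d≡0⇒≡ (suc-injective (trans (sym vy) vy≡1))) u≢y
      ...   | no vy≢1 with q | omit⇒ (trans vy (sym vx) , vy≢1)
      ...     | inj₁ vw | vw≡vz , _ = cyclic 1 (trans (sym vw≡vz) vw)
      -- The triangle inequality through `x` puts `z` too close to `u` for `south-far`.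
      ...     | inj₂ (vz , vw) | _ = contradiction far (<⇒≱ (s≤s (m≤n⇒m≤1+n near-z)))
        where
        far : 2 + (d u y + a) ≤ d u z
        far = ≤-trans (≤-reflexive (sym (trans (+-suc _ _) (cong suc (+-suc _ _)))))
                      (south-far (d u z) refl (ux , uw))
        near-z : d u z ≤ d u y + a
        near-z = ≤-pred (subst₂ (λ i j → i ≤ j + a) vz vx (d-triangle v x z))

    dominates : ∀ {v} → y ~ v → x ~ v
    dominates {v} y~v with gap-1 (subst (λ j → Gap j (d v x)) (~⇒d≡1 (~-sym y~v)) (gap yx v))
    ... | inj₁ vx = ~-sym (d≡1⇒~ vx)
    ... | inj₂ vx = ⊥-elim (escape (noCut y v w (~⇒≢ (~-sym y~v)) w≢y) start)
      where
      vy : d v y ≡ 1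
      vy = ~⇒d≡1 (~-sym y~v)
      w≢y : w ≢ y
      w≢y refl = case trans (sym yw) (d-refl y) of λ ()
      -- At `v` the distances to `z` and `w` cannot differ by four. If they were equal, `v` would be
      -- missed although it is adjacent to `y`, or adjacent to `w`, which is too far from `y` for
      -- that.
      start : South v
      start with south-start (subst (λ j → Near j (d v z)) yz (near y~v z)) (subst (λ j → Near j (d v w)) yw (near y~v w))
      ... | inj₁ vw = trans vx (cong (2 +_) (sym vy)) , vw
      ... | inj₂ (inj₂ (vz , vw)) = ⊥-elim (gap-4 (subst₂ Gap vz vw (gap-sym (gap wz v))))
      ... | inj₂ (inj₁ vz≡vw) with d v w ≟ℕ 1
      ...   | no vw≢1 = case trans (sym vy) (trans (proj₁ (omit⇐ (sym vz≡vw , vw≢1))) vx) of λ ()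
      ...   | yes vw≡1 = case subst₂ Near yw vw≡1 (near y~v w) of λ { (inj₁ ()) ; (inj₂ ()) }
      escape : ∀ {u} → WalkAvoiding G y u w → South u → ⊥
      escape (here _) (_ , ww) = case trans (sym (d-refl w)) ww of λ ()
      escape (step u≢y u~v walk) s = escape walk (south-step u~v u≢y s)

    -- By domination `p` is adjacent to `x` as well, so a `t` other than `x` is at distance two from
    -- both `y` and `x` and is missed: `z` and `w` are equally far from it. As `p` is two closer to
    -- `z` than to `w`, only the value in between remains.
    second-neighbour : ∀ {p t} → y ~ p → t ~ p → t ≢ y → d t w ≡ 2 + d x z
    second-neighbour {p} {t} y~p t~p t≢y with t ≟ᶠ x
    ... | yes refl = xw
    ... | no t≢x = trans tw (cong suc (near-between
            (near x~p z) (subst (λ j → Near j (d p z)) yz (near y~p z))))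
      where
      x~p : x ~ p
      x~p = dominates y~p
      ty : d t y ≡ 2
      ty = ~-~⇒2 t~p y~p t≢y
      tx : d t x ≡ 2
      tx = ~-~⇒2 t~p x~p t≢x
      t-omit : d t w ≡ d t z
      t-omit = proj₁ (omit⇒ (trans ty (sym tx) , λ e → case trans (sym e) ty of λ ()))
      pz : d p z ≡ suc a
      pz = near-between (near x~p z) (subst (λ j → Near j (d p z)) yz (near y~p z))
      pw : d p w ≡ 2 + d p z
      pw = trans (near-between (subst (λ j → Near j (d p w)) xw (near x~p w))
                               (subst (λ j → Near j (d p w)) yw (near y~p w)))
                 (cong (2 +_) (sym pz))
      tw : d t w ≡ suc (d p z)
      tw = near-between (subst (Near (d p z)) (sym t-omit) (near (~-sym t~p) z))
                        (subst (λ j → Near j (d t w)) pw (near (~-sym t~p) w))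

  -- Tails, forks and good pairs.

  Bad : Fin n → Fin n → Set
  Bad y x = ∃ λ w → ∃ λ z → Aligned y x w z

  Tail : Fin n → Set
  Tail y = ∃ λ x → Bad y x

  bad? : ∀ y x → Dec (Bad y x)
  bad? y x = any? λ w → any? λ z → aligned? y x w z

  tail? : ∀ y → Dec (Tail y)
  tail? y = any? (bad? y)

  bad-2 : ∀ {y x} → Bad y x → d y x ≡ 2
  bad-2 (_ , _ , L) = Aligned.yx L

  bad-dominates : ∀ {y x v} → Bad y x → y ~ v → x ~ v
  bad-dominates (_ , _ , L) = dominates L

  -- The first edge of a geodesic from `p` can be replaced by an edge from `q`.
  dominating-closer : ∀ {p q u} → (∀ {t} → p ~ t → q ~ t) → p ≢ u → d q u ≤ d p u
  dominating-closer {p} {q} {u} p⊆q p≢u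
    with k , e ← d≢0 p≢u
    with v , p~v , vu ← d-first e =
    ≤-trans (d-step u (p⊆q p~v)) (≤-reflexive (trans (cong suc vu) (sym e)))

  neighbour : ∀ y → ∃ λ p → y ~ p
  neighbour y
    with v , v≢y , _ ← third 3≤n y y
    with _ , e ← d≢0 (v≢y ∘ sym)
    with p , y~p , _ ← d-first e = p , y~p

  walk-start : ∀ {p u t} → WalkAvoiding G p u t → u ≢ p
  walk-start (here u≢p)     = u≢p
  walk-start (step u≢p _ _) = u≢p

  -- A walk from `y` to a third vertex that avoids `p` leaves `y` through another neighbour.
  another-neighbour : ∀ {y p} → y ~ p → ∃ λ q → q ≢ p × y ~ q
  another-neighbour {y} {p} y~p
    with v , v≢y , v≢p ← third 3≤n y p
    with noCut p y v (~⇒≢ y~p) v≢p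
  ... | here _ = contradiction refl v≢y
  ... | step {y = q} _ y~q walk = q , walk-start walk , y~q

  no-twins : ∀ {p q} → p ≢ q → d p q ≡ 2 → ¬ (∀ u → u ≢ p → u ≢ q → d p u ≡ d q u)
  no-twins {p} {q} p≢q pq e = noTwins p q (p≢q ,
    (λ e₁ → case trans (sym (trans (d≡dist p q) e₁)) pq of λ ()) ,
    λ u u≢p u≢q → trans (sym (d≡dist p u)) (trans (e u u≢p u≢q) (d≡dist q u)))

  twins : ∀ {p q v} → v ~ p → v ~ q → p ≢ q →
    (∀ {t} → p ~ t → q ~ t) → (∀ {t} → q ~ t → p ~ t) → ⊥
  twins v~p v~q p≢q p⊆q q⊆p = no-twins p≢q (~-~⇒2 (~-sym v~p) (~-sym v~q) p≢q)
    λ u u≢p u≢q → ≤-antisym (dominating-closer q⊆p (u≢q ∘ sym)) (dominating-closer p⊆q (u≢p ∘ sym))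

  -- Supplies a vertex `m` at distance two from `v` that does not dominate it, `q` being the
  -- witness.
  record Fork (v : Fin n) : Set where
    constructor fork
    field
      {p q m} : Fin n
      v~p : v ~ p
      v~q : v ~ q
      m~p : m ~ p
      m≁q : ¬ m ~ q

    v≢m : v ≢ m
    v≢m e = m≁q (subst (_~ q) e v~q)

    vm : d v m ≡ 2
    vm = ~-~⇒2 v~p m~p v≢m

    p≢q : p ≢ q
    p≢q e = m≁q (subst (m ~_) e m~p)

  _~?_ : ∀ x y → Dec (x ~ y)
  x ~? y = adj x y ≟ᵇ true

  -- Two neighbours of `v` with the same neighbourhood would be twins, so one of them has a private
  -- neighbour.
  forks : ∀ v → Fork v
  forks v
    with p , v~p ← neighbour v
    with q , q≢p , v~q ← another-neighbour v~p
    with any? (λ m → (m ~? p) ×-dec ¬? (m ~? q)) | any? (λ m → (m ~? q) ×-dec ¬? (m ~? p))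
  ... | yes (m , m~p , m≁q) | _                     = fork v~p v~q m~p m≁q
  ... | no _                | yes (m , m~q , m≁p)   = fork v~q v~p m~q m≁p
  ... | no none             | no none′              = ⊥-elim (twins v~p v~q (q≢p ∘ sym)
    (λ {t} p~t → included none p~t) (λ {t} q~t → included none′ q~t))
    where
    included : ∀ {p q t} → ¬ (∃ λ m → (m ~ p) × ¬ (m ~ q)) → p ~ t → q ~ t
    included {p} {q} {t} none p~t with t ~? q
    ... | yes t~q = ~-sym t~q
    ... | no t≁q  = contradiction (t , ~-sym p~t , t≁q) none

  -- If `y` dominates `v`, it is at least as close to `w` as `v` is. But `v` is then a second
  -- neighbour of `y`, and these are two closer to `w`.
  tail-not-head : ∀ {y x v} → Bad y x → ¬ Bad v y
  tail-not-head {y} {x} {v} (w , z , L) B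
    with p , v~p ← neighbour v =
    contradiction (dominating-closer (bad-dominates B) v≢w) (<⇒≱ (subst₂ _<_ (sym vw) (sym (Aligned.yw L)) (m≤n⇒m≤1+n ≤-refl)))
    where
    v≢y : v ≢ y
    v≢y refl = case trans (sym (d-refl v)) (bad-2 B) of λ ()
    vw : d v w ≡ 2 + d x z
    vw = second-neighbour L (bad-dominates B v~p) v~p v≢y
    v≢w : v ≢ w
    v≢w refl = case trans (sym (d-refl v)) vw of λ ()

  Good : Fin n → Fin n → Set
  Good u v = d u v ≡ 2 × ¬ Bad u v × ¬ Bad v u

  nontails-good : ∀ {u v} → d u v ≡ 2 → ¬ Tail u → ¬ Tail v → Good u v
  nontails-good e ¬u ¬v = e , (λ b → ¬u (_ , b)) , (λ b → ¬v (_ , b))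

  tail-good : ∀ {y p t} → Tail y → y ~ p → ¬ t ~ p → d y t ≡ 2 → Good y t
  tail-good (_ , B) y~p t≁p yt = yt , (λ b → t≁p (bad-dominates b y~p)) , tail-not-head B

  TailPartner : Fin n → Set
  TailPartner y = (∃ λ t → ¬ Tail t × Good y t)
                ⊎ (∃₂ λ s t → s ≢ t × Tail s × Tail t × Good y s × Good y t)

  -- If the fork vertex `m` is itself a tail, `y` is a second neighbour of `m`. Two steps from `y`
  -- towards the far end `w′` lead to a vertex `t` that is three closer to `w′` than `p` is, so `t`
  -- is not adjacent to `p` and cannot dominate `y`.
  tail-partner : ∀ {y} → Tail y → TailPartner y
  tail-partner {y} Y with φ@(fork {p} {q} {m} y~p y~q m~p m≁q) ← forks y | tail? m
  ... | no ¬M = inj₁ (m , ¬M , tail-good Y y~q m≁q (Fork.vm φ))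
  ... | yes M@(x′ , w′ , z′ , L)
    with yw ← second-neighbour L m~p y~p (Fork.v≢m φ)
    with r , y~r , rw ← d-first yw
    with t , r~t , tw ← d-first rw = result
    where
    y≢t : y ≢ t
    y≢t refl = cyclic 1 (trans (sym tw) yw)
    pw : d p w′ ≡ 3 + d x′ z′
    pw = near-between (subst (λ j → Near j (d p w′)) yw (near y~p w′))
                      (subst (λ j → Near j (d p w′)) (Aligned.yw L) (near m~p w′))
    t≁p : ¬ t ~ p
    t≁p t~p = near-3 (subst₂ Near tw pw (near t~p w′))
    good-t : Good y t
    good-t = tail-good Y y~p t≁p (~-~⇒2 y~r (~-sym r~t) y≢t)
    result : TailPartner y
    result with tail? t
    ... | no ¬T = inj₁ (t , ¬T , good-t)
    ... | yes T = inj₂ (m , t , (λ { refl → t≁p m~p }) , M , T ,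
                        tail-good Y y~q m≁q (Fork.vm φ) , good-t)

  -- Two steps along a geodesic to `r`. If they end at a tail, its head takes over: it is adjacent
  -- to the same middle vertex and no farther from `r`.
  parent : ∀ {r v} → ¬ Tail r → ¬ Tail v → v ≢ r → c v ≡ c r →
    ∃ λ q → ¬ Tail q × d v q ≡ 2 × d v r ≡ 2 + d q r
  parent {r} {v} ¬R ¬V v≢r cv with d v r in vr
  ... | zero     = contradiction (d≡0⇒≡ vr) v≢r
  ... | suc zero = contradiction cv (proper _ _ (d≡1⇒~ vr))
  ... | suc (suc k)
    with s , v~s , sr ← d-first vr
    with q , s~q , qr ← d-first sr
    with tail? q
  ...   | no ¬Q = q , ¬Q , ~-~⇒2 v~s (~-sym s~q) v≢q , cong (2 +_) (sym qr)
    where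
    v≢q : v ≢ q
    v≢q refl = case trans (sym vr) qr of λ ()
  ...   | yes Q@(h , B) = h , (λ (_ , B′) → tail-not-head B′ B) , ~-~⇒2 v~s h~s v≢h , cong (2 +_) (sym hr)
    where
    h~s : h ~ s
    h~s = bad-dominates B (~-sym s~q)
    q≢r : q ≢ r
    q≢r refl = ¬R Q
    hr : d h r ≡ k
    hr = ≤-antisym (≤-trans (dominating-closer (bad-dominates B) q≢r) (≤-reflexive qr))
                   (≤-pred (subst (_≤ suc (d h r)) sr (d-step r (~-sym h~s))))
    v≢h : v ≢ h
    v≢h refl = case trans (sym vr) hr of λ ()

-- Classification of pairs that generate the same line.

gap-≤ : ∀ {i j} → Gap i j → i ≤ j → i ≡ j ⊎ j ≡ 2 + i
gap-≤ (inj₁ e)           _   = inj₁ e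
gap-≤ (inj₂ (inj₁ e))    _   = inj₂ e
gap-≤ (inj₂ (inj₂ refl)) i≤j = contradiction (≤-trans (n≤1+n _) i≤j) (<⇒≱ ≤-refl)

-- The possible distances d x z, d y z, d x w, d y w between two pairs {x, y} and {z, w} each lying on the line
-- of the other, when the first distance is minimal.
data Quad : ℕ → ℕ → ℕ → ℕ → Set where
  rectangle : ∀ {a} → Quad a (2 + a) (2 + a) a
  linear    : ∀ {a} → Quad a (2 + a) (2 + a) (4 + a)
  square    : Quad 1 1 1 1
  zigzag₁   : Quad 1 1 1 3
  zigzag₂   : Quad 1 1 3 1
  zigzag₃   : Quad 1 3 1 1

quad : ∀ {i j k l} → Gap i j → Gap i k → Gap k l → Gap j l → i ≤ j → i ≤ k →
  (i ≡ j → i ≡ 1) → (i ≡ k → i ≡ 1) → (k ≡ l → k ≡ 1) → (j ≡ l → j ≡ 1) → Quad i j k l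
quad ij ik kl jl i≤j i≤k ij₁ ik₁ kl₁ jl₁ with gap-≤ ij i≤j | gap-≤ ik i≤k
quad ij ik kl jl i≤j i≤k ij₁ ik₁ kl₁ jl₁ | inj₁ refl | inj₁ refl with refl ← ij₁ refl with gap-1 kl
... | inj₁ refl = square
... | inj₂ refl = zigzag₁
quad ij ik kl jl i≤j i≤k ij₁ ik₁ kl₁ jl₁ | inj₁ refl | inj₂ refl with refl ← ij₁ refl with gap-1 jl
... | inj₁ refl = zigzag₂
... | inj₂ refl = case kl₁ refl of λ ()
quad ij ik kl jl i≤j i≤k ij₁ ik₁ kl₁ jl₁ | inj₂ refl | inj₁ refl with refl ← ik₁ refl with gap-1 kl
... | inj₁ refl = zigzag₃
... | inj₂ refl = case jl₁ refl of λ ()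
quad ij ik (inj₁ refl)        jl i≤j i≤k ij₁ ik₁ kl₁ jl₁ | inj₂ refl | inj₂ refl = case kl₁ refl of λ ()
quad ij ik (inj₂ (inj₁ refl)) jl i≤j i≤k ij₁ ik₁ kl₁ jl₁ | inj₂ refl | inj₂ refl = linear
quad ij ik (inj₂ (inj₂ refl)) jl i≤j i≤k ij₁ ik₁ kl₁ jl₁ | inj₂ refl | inj₂ refl = rectangle

-- The bound is the triangle inequality for two vertices at distance three; it stops their distance
-- difference from growing to five.
zigzag-step : ∀ {i i′ j′} → Near i i′ → Near (3 + i) j′ → j′ ≤ i′ + 3 → j′ ≡ suc i′ ⊎ j′ ≡ 3 + i′
zigzag-step (inj₁ refl) (inj₁ refl) _ = inj₂ refl
zigzag-step (inj₁ refl) (inj₂ refl) _ = inj₁ refl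
zigzag-step (inj₂ refl) (inj₂ refl) _ = inj₂ refl
zigzag-step {i′ = i′} (inj₂ refl) (inj₁ refl) le =
  contradiction (≤-trans (n≤1+n _) (≤-trans le (≤-reflexive (+-comm i′ 3)))) (<⇒≱ ≤-refl)

near-suc : ∀ {i j} → Near (suc i) j → j ≡ i ⊎ j ≡ 2 + i
near-suc (inj₁ e)    = inj₂ e
near-suc (inj₂ refl) = inj₁ refl

module SameLine {n : ℕ} (G : Graph n) (connected : Connected G) (3≤n : 3 ≤ n)
    (noCut : NoCutVertex G)
    (c : Fin n → Bool) (proper : ∀ x y → Graph.adj G x y ≡ true → c x ≢ c y)
    (noTwins : NoTwins G) where
  open Lines G connected 3≤n noCut c proper noTwins public

  record Same (x y z w : Fin n) : Set where
    constructor same-line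
    field
      xy : d x y ≡ 2
      zw : d z w ≡ 2
      eq : line x y ≡ line z w

    transfer : ∀ {u} → Omit x y u → Omit z w u
    transfer = omit-transfer xy zw eq

  same-sym : ∀ {x y z w} → Same x y z w → Same z w x y
  same-sym (same-line xy zw eq) = same-line zw xy (sym eq)

  same-swapˡ : ∀ {x y z w} → Same x y z w → Same y x z w
  same-swapˡ (same-line xy zw eq) = same-line (trans (d-sym _ _) xy) zw (trans (line-sym _ _) eq)

  same-swapʳ : ∀ {x y z w} → Same x y z w → Same x y w z
  same-swapʳ = same-sym ∘ same-swapˡ ∘ same-sym

  -- The vertex `z` lies on its own line, so the line of `x` and `y` cannot miss it.
  hits : ∀ {x y z w} → Same x y z w → d z x ≡ d z y → d z x ≡ 1
  hits {x} {y} {z} {w} S e with d z x ≟ℕ 1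
  ... | yes e₁ = e₁
  ... | no ≢1  = case trans (sym (d-refl z)) (trans (proj₁ (Same.transfer S (e , ≢1))) (Same.zw S)) of λ ()

  module _ {x y z w} (S : Same x y z w) where
    open Same S

    -- A neighbour of z outside {x, y} would be omitted by the line of x and y.
    only-neighbours : x ~ z → y ~ z → ∀ {t} → t ~ z → t ≡ x ⊎ t ≡ y
    only-neighbours x~z y~z {t} t~z with t ≟ᶠ x | t ≟ᶠ y
    ... | yes e | _     = inj₁ e
    ... | no _  | yes e = inj₂ e
    ... | no t≢x | no t≢y = contradiction (~⇒d≡1 t~z) (proj₂ (transfer
          (trans (~-~⇒2 t~z x~z t≢x) (sym (~-~⇒2 t~z y~z t≢y)) ,
           λ e → case trans (sym e) (~-~⇒2 t~z x~z t≢x) of λ ())))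

    -- A common neighbour of `x` and `y` is equally far from `z` and `w`, hence missed by their
    -- line, but it lies on the line of `x` and `y`.
    not-rectangle : ∀ {a} → d x z ≡ suc a → d y z ≡ 3 + a → d x w ≡ 3 + a → d y w ≡ suc a → ⊥
    not-rectangle xz yz xw yw with p , x~p , y~p ← midpoint xy =
      proj₂ (Same.transfer (same-sym S) (trans pz (sym pw) , λ e → case trans (sym e) pz of λ ()))
        (~⇒d≡1 (~-sym x~p))
      where
      pz : d p z ≡ _
      pz = near-between (subst (λ j → Near j (d p z)) xz (near x~p z)) (subst (λ j → Near j (d p z)) yz (near y~p z))
      pw : d p w ≡ _
      pw = near-between (subst (λ j → Near j (d p w)) yw (near y~p w)) (subst (λ j → Near j (d p w)) xw (near x~p w))

    -- Seen from `u`, both `z` and `w` lie one step beyond `x`; unless that distance is one, `u` is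
    -- missed by their line but not by the line of `x` and `y`.
    square-closer : x ~ z → y ~ z → x ~ w → y ~ w → ∀ {u} → d u y ≡ 2 + d u x → u ≡ x
    square-closer x~z y~z x~w y~w {u} uy = conclude (d u z ≟ℕ 1)
      where
      corner : ∀ {p} → x ~ p → y ~ p → d u p ≡ suc (d u x)
      corner {p} x~p y~p = near-between (near′ x~p u) (subst (λ j → Near j (d u p)) uy (near′ y~p u))
      conclude : Dec (d u z ≡ 1) → u ≡ x
      conclude (yes uz≡1) = d≡0⇒≡ (suc-injective (trans (sym (corner x~z y~z)) uz≡1))
      conclude (no uz≢1)  = cyclic 1 (trans (proj₁ (Same.transfer (same-sym S)
        (trans (corner x~z y~z) (sym (corner x~w y~w)) , uz≢1))) uy)

  not-square : ∀ {x y z w} → Same x y z w → x ~ z → y ~ z → x ~ w → y ~ w → ⊥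
  not-square {x} {y} S x~z y~z x~w y~w = no-twins
    (λ { refl → case trans (sym (d-refl x)) (Same.xy S) of λ () }) (Same.xy S)
    (λ u u≢x u≢y → trans (d-sym x u) (trans (equidistant u u≢x u≢y) (d-sym u y)))
    where
    equidistant : ∀ u → u ≢ x → u ≢ y → d u x ≡ d u y
    equidistant u u≢x u≢y with gap (Same.xy S) u
    ... | inj₁ e        = e
    ... | inj₂ (inj₁ e) = contradiction (square-closer S x~z y~z x~w y~w e) u≢x
    ... | inj₂ (inj₂ e) = contradiction (square-closer (same-swapˡ S) y~z x~z y~w x~w e) u≢y

  -- For a path x, z, y, w the inner vertices z and y have degree two, so a walk from x to w that avoids z
  -- meets a vertex u with d u w ≡ suc (d u x); then u is omitted by the line of z and w only.
  not-zigzag : ∀ {x y z w} → Same x y z w → x ~ z → z ~ y → y ~ w → d x w ≡ 3 → ⊥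
  not-zigzag {x} {y} {z} {w} S x~z z~y y~w xw = walk-escapes (noCut z x w (~⇒≢ x~z) w≢z)
      (trans xw (cong (3 +_) (sym (d-refl x))))
    where
    open Same S
    w≢z : w ≢ z
    w≢z refl = case trans (sym (d-refl w)) zw of λ ()
    around-z : ∀ {t} → t ~ z → t ≡ x ⊎ t ≡ y
    around-z = only-neighbours S x~z (~-sym z~y)
    around-y : ∀ {t} → t ~ y → t ≡ z ⊎ t ≡ w
    around-y = only-neighbours (same-swapʳ (same-sym S)) z~y (~-sym y~w)
    yw : d y w ≡ 1
    yw = ~⇒d≡1 y~w

    off-balance : ∀ {u} → u ≢ z → d u w ≢ suc (d u x)
    off-balance {u} u≢z uw with near-suc (subst (λ j → Near j (d u y)) uw (near′ (~-sym y~w) u))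
    ... | inj₂ uy with uz ← near-between (near′ x~z u) (subst (λ j → Near j (d u z)) uy (near′ (~-sym z~y) u))
                  with d u z ≟ℕ 1
    ...   | no uz≢1 = cyclic 1 (trans (proj₁ (Same.transfer (same-sym S) (trans uz (sym uw) , uz≢1))) uy)
    ...   | yes uz≡1 with refl ← d≡0⇒≡ {u} {x} (suc-injective (trans (sym uz) uz≡1)) =
            case trans (sym xw) (trans uw (cong suc (d-refl x))) of λ ()
    -- Here `x` and `y` are equally far from `u`. A geodesic from `y` to `u` must leave through `z`,
    -- since `w` is farther, and then through `x` or `y`, both farther from `u` than `z`.
    off-balance {u} u≢z uw | inj₁ uy
      with k , yu ← d≢0 {y} {u} (λ { refl → case trans (sym (d-refl y)) (trans uy (trans (d-sym y x) xy)) of λ () })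
      with v , y~v , vu ← d-first yu
      with around-y (~-sym y~v)
    ... | inj₂ refl = case trans (sym (trans (d-sym w u) (trans uw (cong suc (trans (sym uy) (trans (d-sym u y) yu)))))) vu of λ ()
    ... | inj₁ refl
      with l , zu ← d≢0 (u≢z ∘ sym)
      with t , z~t , tu ← d-first zu
      with around-z (~-sym z~t)
    ...   | inj₁ refl = case trans (sym tu) (trans (d-sym x u) (trans (sym uy) (trans (d-sym u y) (trans yu (cong suc (trans (sym vu) zu)))))) of λ ()
    ...   | inj₂ refl = case trans (sym tu) (trans yu (cong suc (trans (sym vu) zu))) of λ ()

    -- The excess of the distance to `w` over that to `x` starts at three and can only stay or drop
    -- to one, but at `w` it would be negative.
    walk-escapes : ∀ {u} → WalkAvoiding G z u w → d u w ≡ 3 + d u x → ⊥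
    walk-escapes (here _) e = case trans (sym (d-refl w)) e of λ ()
    walk-escapes {u} (step {y = v} u≢z u~v walk) e
      with zigzag-step (near u~v x) (subst (λ j → Near j (d v w)) e (near u~v w))
             (subst (λ j → d v w ≤ d v x + j) xw (d-triangle v x w))
    ... | inj₁ e′ = off-balance (walk-start walk) e′
    ... | inj₂ e′ = walk-escapes walk e′

  classify-min : ∀ {x y z w} → Same x y z w → d x z ≤ d y z → d x z ≤ d x w →
    (x ≡ z × y ≡ w) ⊎ Aligned y x w z
  classify-min {x} {y} {z} {w} S le₁ le₂ = go refl refl refl refl
    (quad (subst₂ Gap (d-sym z x) (d-sym z y) (gap xy z)) (gap zw x)
      (subst₂ Gap (d-sym w x) (d-sym w y) (gap xy w)) (gap zw y) le₁ le₂
      (λ e → trans (d-sym x z) (hits S (trans (d-sym z x) (trans e (d-sym y z)))))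
      (hits (same-sym S))
      (λ e → trans (d-sym x w) (hits (same-swapʳ S) (trans (d-sym w x) (trans e (d-sym y w)))))
      (hits (same-swapʳ (same-sym S))))
    where
    open Same S
    go : ∀ {i j k l} → d x z ≡ i → d y z ≡ j → d x w ≡ k → d y w ≡ l → Quad i j k l →
      (x ≡ z × y ≡ w) ⊎ Aligned y x w z
    go xz yz xw yw (rectangle {zero})  = inj₁ (d≡0⇒≡ xz , d≡0⇒≡ yw)
    go xz yz xw yw (rectangle {suc a}) = ⊥-elim (not-rectangle S xz yz xw yw)
    go xz yz xw yw linear = inj₂ (aligned (trans (d-sym y x) xy) (trans (d-sym w z) zw)
      (trans yz (cong (2 +_) (sym xz))) (trans xw (cong (2 +_) (sym xz))) (trans yw (cong (4 +_) (sym xz)))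
      (trans (line-sym y x) (trans eq (line-sym z w))))
    go xz yz xw yw square = ⊥-elim (not-square S (d≡1⇒~ xz) (d≡1⇒~ yz) (d≡1⇒~ xw) (d≡1⇒~ yw))
    go xz yz xw yw zigzag₁ = ⊥-elim (not-zigzag (same-swapˡ S) (d≡1⇒~ yz) (~-sym (d≡1⇒~ xz)) (d≡1⇒~ xw) yw)
    go xz yz xw yw zigzag₂ = ⊥-elim (not-zigzag S (d≡1⇒~ xz) (~-sym (d≡1⇒~ yz)) (d≡1⇒~ yw) xw)
    go xz yz xw yw zigzag₃ = ⊥-elim (not-zigzag (same-sym S) (~-sym (d≡1⇒~ xz)) (d≡1⇒~ xw) (~-sym (d≡1⇒~ yw)) (trans (d-sym z y) yz))

  data Classified (x y z w : Fin n) : Set where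
    equal     : x ≡ z → y ≡ w → Classified x y z w
    swapped   : x ≡ w → y ≡ z → Classified x y z w
    alignedˣᶻ : Aligned x y z w → Classified x y z w
    alignedˣʷ : Aligned x y w z → Classified x y z w
    alignedʸᶻ : Aligned y x z w → Classified x y z w
    alignedʸʷ : Aligned y x w z → Classified x y z w

  -- Swapping ends makes any cross distance play the role of `d x z`; it need only be minimal among
  -- those that share an end with it.
  classify : ∀ {x y z w} → Same x y z w → Classified x y z w
  classify {x} {y} {z} {w} S = pick (≤-total (d x z) (d y z)) (≤-total (d x z) (d x w)) (≤-total (d x w) (d y w)) (≤-total (d y z) (d y w))
    where
    xz-min : d x z ≤ d y z → d x z ≤ d x w → Classified x y z w
    xz-min p q = [ (λ (e , e′) → equal e e′) , alignedʸʷ ]′ (classify-min S p q)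
    yz-min : d y z ≤ d x z → d y z ≤ d y w → Classified x y z w
    yz-min p q = [ (λ (e , e′) → swapped e′ e) , alignedˣʷ ]′ (classify-min (same-swapˡ S) p q)
    xw-min : d x w ≤ d y w → d x w ≤ d x z → Classified x y z w
    xw-min p q = [ (λ (e , e′) → swapped e e′) , alignedʸᶻ ]′ (classify-min (same-swapʳ S) p q)
    yw-min : d y w ≤ d x w → d y w ≤ d y z → Classified x y z w
    yw-min p q = [ (λ (e , e′) → equal e′ e) , alignedˣᶻ ]′ (classify-min (same-swapˡ (same-swapʳ S)) p q)
    pick : d x z ≤ d y z ⊎ d y z ≤ d x z → d x z ≤ d x w ⊎ d x w ≤ d x z →
      d x w ≤ d y w ⊎ d y w ≤ d x w → d y z ≤ d y w ⊎ d y w ≤ d y z → Classified x y z w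
    pick (inj₁ p) (inj₁ q) _        _        = xz-min p q
    pick (inj₁ p) (inj₂ q) (inj₁ r) _        = xw-min r q
    pick (inj₁ p) (inj₂ q) (inj₂ r) _        = yw-min r (≤-trans r (≤-trans q p))
    pick (inj₂ p) _        _        (inj₁ s) = yz-min p s
    pick (inj₂ p) _        (inj₂ r) (inj₂ s) = yw-min r s
    pick (inj₂ p) _        (inj₁ r) (inj₂ s) = xw-min r (≤-trans r (≤-trans s p))

  good-unique : ∀ {u v s t} → Good u v → d s t ≡ 2 → line u v ≡ line s t →
    (u ≡ s × v ≡ t) ⊎ (u ≡ t × v ≡ s)
  good-unique (uv , ¬uv , ¬vu) st eq with classify (same-line uv st eq)
  ... | equal e e′   = inj₁ (e , e′)
  ... | swapped e e′ = inj₂ (e , e′)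
  ... | alignedˣᶻ L = contradiction (_ , _ , L) ¬uv
  ... | alignedˣʷ L = contradiction (_ , _ , L) ¬uv
  ... | alignedʸᶻ L = contradiction (_ , _ , L) ¬vu
  ... | alignedʸʷ L = contradiction (_ , _ , L) ¬vu

  -- Every other case identifies the tails or turns one of them into a head.
  bad-aligned : ∀ {y x w z} → Bad y x → Bad w z → y ≢ w → line y x ≡ line w z → Aligned y x w z
  bad-aligned B B′ y≢w eq with classify (same-line (bad-2 B) (bad-2 B′) eq)
  ... | equal e _      = contradiction e y≢w
  ... | swapped e refl = contradiction (subst (λ v → Bad v _) e B) (tail-not-head B′)
  ... | alignedˣᶻ L    = L
  ... | alignedˣʷ L    = contradiction (_ , _ , aligned-sym L) (tail-not-head B′)
  ... | alignedʸᶻ L    = contradiction (_ , _ , L) (tail-not-head B)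
  ... | alignedʸʷ L    = contradiction (_ , _ , L) (tail-not-head B)

-- Double counting with oriented pairs.

double-count : ∀ {A : Set} {n} (xs : List A) (f : Fin n → Fin 2 → A × Fin 2) →
  (∀ i j → proj₁ (f i j) ∈ᴸ xs) →
  (∀ i j i′ j′ → f i j ≡ f i′ j′ → i ≡ i′ × j ≡ j′) → n ≤ length xs
double-count {n = n} xs f f∈ f-injective = *-cancelʳ-≤ n (length xs) 2 (injective⇒≤ {f = F} F-injective)
  where
  code : Fin n → Fin 2 → Fin (length xs * 2)
  code i j = combine (index (f∈ i j)) (proj₂ (f i j))

  code-injective : ∀ i j i′ j′ → code i j ≡ code i′ j′ → i ≡ i′ × j ≡ j′
  code-injective i j i′ j′ e
    with same-index , same-bit ← combine-injective (index (f∈ i j)) _ (index (f∈ i′ j′)) _ e =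
    f-injective i j i′ j′ (cong₂ _,_
      (trans (lookup-index (f∈ i j)) (trans (cong (lookupᴸ xs) same-index) (sym (lookup-index (f∈ i′ j′)))))
      same-bit)

  F : Fin (n * 2) → Fin (length xs * 2)
  F k = code (proj₁ (remQuot {n} 2 k)) (proj₂ (remQuot {n} 2 k))

  F-injective : ∀ {k k′} → F k ≡ F k′ → k ≡ k′
  F-injective {k} {k′} e with i≡ , j≡ ← code-injective _ _ _ _ e =
    trans (sym (combine-remQuot {n} 2 k)) (trans (cong₂ combine i≡ j≡) (combine-remQuot {n} 2 k′))

bit : ∀ {A : Set} → Dec A → Fin 2
bit (yes _) = zero
bit (no _)  = suc zero

-- A line determines at most an unordered pair; this bit recovers the order.
orientation : ∀ {n} → Fin n → Fin n → Fin 2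
orientation u v = bit (toℕ u <? toℕ v)

orientation-swap : ∀ {n} {u v : Fin n} → u ≢ v → orientation u v ≢ orientation v u
orientation-swap {u = u} {v} u≢v = bits-differ (toℕ u <? toℕ v) (toℕ v <? toℕ u)
  where
  bits-differ : (D : Dec (toℕ u < toℕ v)) (D′ : Dec (toℕ v < toℕ u)) → bit D ≢ bit D′
  bits-differ (yes u<v) (yes v<u) _ = contradiction v<u (<⇒≯ u<v)
  bits-differ (no u≮v)  (no v≮u)  _ = contradiction (toℕ-injective (≤-antisym (≮⇒≥ v≮u) (≮⇒≥ u≮v))) u≢v

-- Assignment of two ordered pairs to every vertex.

module Counting {n : ℕ} (G : Graph n) (connected : Connected G) (3≤n : 3 ≤ n)
    (noCut : NoCutVertex G)
    (c : Fin n → Bool) (proper : ∀ x y → Graph.adj G x y ≡ true → c x ≢ c y)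
    (noTwins : NoTwins G) where
  open SameLine G connected 3≤n noCut c proper noTwins

  d≡2⇒≢ : ∀ {u v} → d u v ≡ 2 → u ≢ v
  d≡2⇒≢ {u} e refl = case trans (sym (d-refl u)) e of λ ()

  good-sym : ∀ {u v} → Good u v → Good v u
  good-sym {u} {v} (uv , ¬uv , ¬vu) = trans (d-sym v u) uv , ¬vu , ¬uv

  head-not-tail : ∀ {y x} → Bad y x → ¬ Tail x
  head-not-tail B (_ , B′) = tail-not-head B′ B

  -- The additional pair of a root. A `level` pair is good and never joins a vertex to its parent,
  -- as its ends are equally far from `r`.
  data Extra (r e₁ e₂ : Fin n) : Set where
    bad   : Bad e₁ e₂ → Extra r e₁ e₂
    level : d e₁ e₂ ≡ 2 → ¬ Tail e₁ → ¬ Tail e₂ → d e₁ r ≡ d e₂ r → Extra r e₁ e₂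

  -- How the vertices of colour b are assigned pairs at distance two. Without tails every vertex gets halves of two
  -- pairs. Otherwise a non-tail gets the pair formed with its parent towards the root r, and r gets {e₁, e₂}.
  data Side (b : Bool) : Set where
    tailless : (∀ v → c v ≡ b → ¬ Tail v) → Side b
    rooted   : ∀ r e₁ e₂ → c r ≡ b → c e₁ ≡ b → ¬ Tail r → Extra r e₁ e₂ → Side b

  -- The one assigned pair of a side that may fail to be good, so that `good-unique` does not cover
  -- it.
  Special : ∀ {b} → Side b → Fin n → Fin n → Set
  Special (tailless _) u v = ⊥
  Special (rooted _ _ _ _ _ _ (level _ _ _ _)) u v = ⊥
  Special (rooted _ e₁ e₂ _ _ _ (bad _)) u v = (u ≡ e₁ × v ≡ e₂) ⊎ (u ≡ e₂ × v ≡ e₁)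

  special-sym : ∀ {b} (S : Side b) {u v} → Special S u v → Special S v u
  special-sym (rooted _ _ _ _ _ _ (bad _)) (inj₁ (p , q)) = inj₂ (q , p)
  special-sym (rooted _ _ _ _ _ _ (bad _)) (inj₂ (p , q)) = inj₁ (q , p)

  special-unique : ∀ {b} (S : Side b) {u v s t} → Special S u v → Special S s t →
    (u ≡ s × v ≡ t) ⊎ (u ≡ t × v ≡ s)
  special-unique (rooted _ _ _ _ _ _ (bad _)) (inj₁ (refl , refl)) (inj₁ (refl , refl)) = inj₁ (refl , refl)
  special-unique (rooted _ _ _ _ _ _ (bad _)) (inj₁ (refl , refl)) (inj₂ (refl , refl)) = inj₂ (refl , refl)
  special-unique (rooted _ _ _ _ _ _ (bad _)) (inj₂ (refl , refl)) (inj₁ (refl , refl)) = inj₂ (refl , refl)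
  special-unique (rooted _ _ _ _ _ _ (bad _)) (inj₂ (refl , refl)) (inj₂ (refl , refl)) = inj₁ (refl , refl)

  -- Reads the owner off the ordered pair alone, so different vertices cannot share a token. Two
  -- tails split their pair by order, a tail owns its good pair with a non-tail, a child owns the
  -- pair with its parent, and the root owns bad and level pairs.
  ownerAt : Fin n → Fin n → Fin n → Fin n
  ownerAt r u v = pick (does (tail? u)) (does (tail? v))
    where
    pick : Bool → Bool → Fin n
    pick true  true  = u
    pick true  false = if does (bad? u v) then r else u
    pick false true  = if does (bad? v u) then r else v
    pick false false = if does (d u r <? d v r) then v else if does (d v r <? d u r) then u else r

  owner : ∀ {b} → Side b → Fin n → Fin n → Fin n
  owner (tailless _)           u v = u
  owner (rooted r _ _ _ _ _ _) u v = ownerAt r u v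

  owner-tails : ∀ r {u v} → Tail u → Tail v → ownerAt r u v ≡ u
  owner-tails r {u} {v} U V rewrite dec-true (tail? u) U | dec-true (tail? v) V = refl

  owner-mixed : ∀ r {u v} → Tail u → ¬ Tail v → ¬ Bad u v → ownerAt r u v ≡ u × ownerAt r v u ≡ u
  owner-mixed r {u} {v} U ¬V ¬B
    rewrite dec-true (tail? u) U | dec-false (tail? v) ¬V | dec-false (bad? u v) ¬B = refl , refl

  owner-bad : ∀ r {u v} → Bad u v → ownerAt r u v ≡ r × ownerAt r v u ≡ r
  owner-bad r {u} {v} B
    rewrite dec-true (tail? u) (_ , B) | dec-false (tail? v) (head-not-tail B) | dec-true (bad? u v) B = refl , refl

  owner-child : ∀ r {u v} → ¬ Tail u → ¬ Tail v → d v r < d u r → ownerAt r u v ≡ u × ownerAt r v u ≡ u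
  owner-child r {u} {v} ¬U ¬V v<u
    rewrite dec-false (tail? u) ¬U | dec-false (tail? v) ¬V
          | dec-true (d v r <? d u r) v<u | dec-false (d u r <? d v r) (<⇒≯ v<u) = refl , refl

  owner-level : ∀ r {u v} → ¬ Tail u → ¬ Tail v → d u r ≡ d v r → ownerAt r u v ≡ r × ownerAt r v u ≡ r
  owner-level r {u} {v} ¬U ¬V e
    rewrite dec-false (tail? u) ¬U | dec-false (tail? v) ¬V
          | dec-false (d v r <? d u r) (<-irrefl (sym e)) | dec-false (d u r <? d v r) (<-irrefl e) = refl , refl

  record Token {b} (S : Side b) (v : Fin n) : Set where
    constructor token
    field
      {u₁ u₂} : Fin n
      dist-2  : d u₁ u₂ ≡ 2
      colour  : c u₁ ≡ b
      owned   : owner S u₁ u₂ ≡ v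
      kind    : Good u₁ u₂ ⊎ Special S u₁ u₂

  open Token using (u₁; u₂)

  Pair : ∀ {b} → Side b → Fin n → Set
  Pair S v = ∃₂ λ (t₁ t₂ : Token S v) → ¬ (u₁ t₁ ≡ u₁ t₂ × u₂ t₁ ≡ u₂ t₂)

  both-ways : ∀ {b} {S : Side b} {v s t} → d s t ≡ 2 → c s ≡ b →
    owner S s t ≡ v × owner S t s ≡ v → Good s t ⊎ Special S s t → Pair S v
  both-ways {S = S} {s = s} {t} st cs (own , own′) kind =
    token st cs own kind ,
    token (trans (d-sym t s) st) (trans (sym (colour-2 st)) cs) own′ ([ inj₁ ∘ good-sym , inj₂ ∘ special-sym S ]′ kind) ,
    λ (s≡t , _) → d≡2⇒≢ st s≡t

  two-halves : ∀ {b} {S : Side b} {v s t} → s ≢ t → c v ≡ b → Good v s → Good v t →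
    owner S v s ≡ v → owner S v t ≡ v → Pair S v
  two-halves s≢t cv vs vt own own′ =
    token (proj₁ vs) cv own (inj₁ vs) , token (proj₁ vt) cv own′ (inj₁ vt) , λ (_ , s≡t) → s≢t s≡t

  tokens : ∀ {b} (S : Side b) v → c v ≡ b → Pair S v
  tokens S@(tailless ¬tail) v cv
    with φ@(fork v~p v~q m~p m≁q) ← forks v
    -- Unlike `m`, the vertex `t` is adjacent to `q`, so the two partners of `v` differ.
    with t , t≢v , q~t ← another-neighbour (~-sym v~q) =
    two-halves (λ { refl → m≁q (~-sym q~t) }) cv (good (Fork.vm φ)) (good (~-~⇒2 v~q (~-sym q~t) (t≢v ∘ sym))) refl refl
    where
    good : ∀ {s} → d v s ≡ 2 → Good v s
    good {s} vs = nontails-good vs (¬tail v cv) (¬tail s (trans (sym (colour-2 vs)) cv))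
  tokens S@(rooted r e₁ e₂ cr ce ¬R extra) v cv with v ≟ᶠ r
  ... | yes refl = root extra
    where
    root : (E : Extra v e₁ e₂) → Pair (rooted v e₁ e₂ cr ce ¬R E) v
    root (bad B)            = both-ways (bad-2 B) ce (owner-bad v B) (inj₂ (inj₁ (refl , refl)))
    root (level e ¬E₁ ¬E₂ l) = both-ways e ce (owner-level v ¬E₁ ¬E₂ l) (inj₁ (nontails-good e ¬E₁ ¬E₂))
  ... | no v≢r with tail? v
  ...   | no ¬V
    with q , ¬Q , vq , closer ← parent ¬R ¬V v≢r (trans cv (sym cr)) =
    both-ways vq cv (owner-child r ¬V ¬Q (≤-trans (n≤1+n _) (≤-reflexive (sym closer)))) (inj₁ (nontails-good vq ¬V ¬Q))
  ...   | yes V = by-partner (tail-partner V)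
    where
    by-partner : TailPartner v → Pair S v
    by-partner (inj₁ (t , ¬T , good)) =
      both-ways (proj₁ good) cv (owner-mixed r V ¬T (proj₁ (proj₂ good))) (inj₁ good)
    by-partner (inj₂ (s , t , s≢t , S′ , T′ , good , good′)) =
      two-halves s≢t cv good good′ (owner-tails r V S′) (owner-tails r V T′)

  bad-side : ∀ {b y x} → Bad y x → c y ≡ b → Side b
  bad-side {y = y} {x} B cy = rooted x y x (trans (sym (colour-2 (bad-2 B))) cy) cy (head-not-tail B) (bad B)

  special-line : ∀ {b y x} (B : Bad y x) (cy : c y ≡ b) {u v} → Special (bad-side B cy) u v → line u v ≡ line y x
  special-line B cy (inj₁ (refl , refl)) = refl
  special-line B cy (inj₂ (refl , refl)) = line-sym _ _

  record Sides : Set where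
    constructor sides
    field
      S₀    : Side false
      S₁    : Side true
      apart : ∀ {u v s t} → Special S₀ u v → Special S₁ s t → line u v ≢ line s t

  bad-sides : ∀ {y x w z} → Bad y x → c y ≡ false → Bad w z → c w ≡ true → line y x ≢ line w z → Sides
  bad-sides B cy B′ cw ≢l = sides (bad-side B cy) (bad-side B′ cw) λ s s′ e →
    ≢l (trans (sym (special-line B cy s)) (trans e (special-line B′ cw s′)))

  -- Two bad pairs with different tails and a common line are aligned, which puts their tails at
  -- least four apart.
  close-tails-apart : ∀ {y x e h} → Bad y x → Bad e h → y ≢ e → d y e ≤ 3 → line y x ≢ line e h
  close-tails-apart B B′ y≢e le eq =
    contradiction (≤-trans (≤-reflexive (sym (Aligned.yw (bad-aligned B B′ y≢e eq)))) le)
      (<⇒≱ (s≤s (s≤s (s≤s (s≤s z≤n)))))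

  opposite : ∀ {u v} → u ~ v → c u ≡ false → c v ≡ true
  opposite u~v cu = trans (¬-not (proper _ _ (~-sym u~v))) (cong not cu)

  -- If the line of a bad pair {y, x} is generated on both sides, then x has three pairwise distinct neighbours
  -- within distance three of y; unless one of them is the tail of a bad pair with another line, they form
  -- a triangle of good pairs, one edge of which is not used by the tree rooted at the opposite vertex.
  shared-line : ∀ {y x w z} → Bad y x → c y ≡ false → c w ≡ true → Aligned y x w z → Sides
  shared-line {y} {x} {w} {z} B cy cw L
    with φ@(fork {p} {q} y~p y~q _ _) ← forks y
    with a , xz ← d≢0 {x} {z} (λ { refl → case trans (sym cy) (trans (colour-2 (Aligned.yx L))
           (trans (sym (colour-2 (Aligned.wz L))) cw)) of λ () })
    with r , x~r , rz ← d-first xz = choose (tail? p) (tail? q) (tail? r)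
    where
    x~p : x ~ p
    x~p = bad-dominates B y~p
    x~q : x ~ q
    x~q = bad-dominates B y~q
    cx : c x ≡ false
    cx = trans (sym (colour-2 (bad-2 B))) cy
    -- The vertex `z` is at distance `3 + a` from `y` but only `a` from `r`. Hence `r` is neither
    -- `p` nor `q`.
    y≁r : ¬ y ~ r
    y≁r y~r = contradiction
      (≤-trans (≤-reflexive (sym (trans (Aligned.yz L) (cong (2 +_) xz))))
        (≤-trans (d-step z y~r) (≤-reflexive (cong suc rz))))
      (<⇒≱ (s≤s (s≤s (n≤1+n _))))
    use : ∀ {e} → x ~ e → Tail e → Sides
    use {e} x~e (h , B′) = bad-sides B cy B′ (opposite x~e cx)
      (close-tails-apart B B′ (λ { refl → proper _ _ x~e (trans cx (sym cy)) })
        (≤-trans (d-triangle y x e) (≤-reflexive (cong₂ _+_ (bad-2 B) (~⇒d≡1 x~e)))))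
    p≢r : p ≢ r
    p≢r refl = y≁r y~p
    q≢r : q ≢ r
    q≢r refl = y≁r y~q
    around-x : ∀ {s t} → x ~ s → x ~ t → s ≢ t → d s t ≡ 2
    around-x x~s x~t = ~-~⇒2 (~-sym x~s) (~-sym x~t)
    choose : Dec (Tail p) → Dec (Tail q) → Dec (Tail r) → Sides
    choose (yes P) _ _ = use x~p P
    choose _ (yes Q) _ = use x~q Q
    choose _ _ (yes R) = use x~r R
    choose (no ¬P) (no ¬Q) (no ¬R) = sides (bad-side B cy)
      (rooted p q r (opposite y~p cy) (opposite y~q cy) ¬P
        (level (around-x x~q x~r q≢r) ¬Q ¬R
          (trans (around-x x~q x~p (Fork.p≢q φ ∘ sym)) (sym (around-x x~r x~p (p≢r ∘ sym))))))
      λ _ ()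

  tail-of : ∀ b → Dec (∃ λ y → Tail y × c y ≡ b)
  tail-of b = any? λ y → tail? y ×-dec c y ≟ᵇ b

  choose-sides : Sides
  choose-sides = go (tail-of false) (tail-of true)
    where
    free : ∀ {b} → ¬ (∃ λ y → Tail y × c y ≡ b) → Side b
    free none = tailless λ v cv V → none (v , V , cv)
    go : Dec (∃ λ y → Tail y × c y ≡ false) → Dec (∃ λ y → Tail y × c y ≡ true) → Sides
    go (no none) (no none′)                = sides (free none) (free none′) λ ()
    go (no none) (yes (w , (z , B) , cw))  = sides (free none) (bad-side B cw) λ ()
    go (yes (y , (x , B) , cy)) (no none)  = sides (bad-side B cy) (free none) λ _ ()
    go (yes (y , (x , B) , cy)) (yes (w , (z , B′) , cw)) with ≡-dec _≟ᵇ_ (line y x) (line w z)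
    ... | no ≢l = bad-sides B cy B′ cw ≢l
    ... | yes e = shared-line B cy cw (bad-aligned B B′ (λ { refl → case trans (sym cy) cw of λ () }) e)

  open Sides choose-sides

  side : ∀ b → Side b
  side false = S₀
  side true  = S₁

  same-pair : ∀ {b b′ v v′} (t : Token (side b) v) (t′ : Token (side b′) v′) →
    line (u₁ t) (u₂ t) ≡ line (u₁ t′) (u₂ t′) →
    (u₁ t ≡ u₁ t′ × u₂ t ≡ u₂ t′) ⊎ (u₁ t ≡ u₂ t′ × u₂ t ≡ u₁ t′)
  same-pair {b} {b′} t t′ eq = go b b′ (Token.kind t) (Token.kind t′)
    where
    reverse : ∀ {u v s t : Fin n} → (s ≡ u × t ≡ v) ⊎ (s ≡ v × t ≡ u) → (u ≡ s × v ≡ t) ⊎ (u ≡ t × v ≡ s)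
    reverse (inj₁ (p , q)) = inj₁ (sym p , sym q)
    reverse (inj₂ (p , q)) = inj₂ (sym q , sym p)
    go : ∀ b b′ → Good (u₁ t) (u₂ t) ⊎ Special (side b) (u₁ t) (u₂ t) →
      Good (u₁ t′) (u₂ t′) ⊎ Special (side b′) (u₁ t′) (u₂ t′) →
      (u₁ t ≡ u₁ t′ × u₂ t ≡ u₂ t′) ⊎ (u₁ t ≡ u₂ t′ × u₂ t ≡ u₁ t′)
    go _     _     (inj₁ good) _           = good-unique good (Token.dist-2 t′) eq
    go _     _     (inj₂ _)    (inj₁ good) = reverse (good-unique good (Token.dist-2 t) (sym eq))
    go false false (inj₂ s)    (inj₂ s′)   = special-unique S₀ s s′
    go true  true  (inj₂ s)    (inj₂ s′)   = special-unique S₁ s s′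
    go false true  (inj₂ s)    (inj₂ s′)   = contradiction eq (apart s s′)
    go true  false (inj₂ s)    (inj₂ s′)   = contradiction (sym eq) (apart s′ s)

  pick : ∀ v → Fin 2 → Token (side (c v)) v
  pick v zero    = proj₁ (tokens (side (c v)) v refl)
  pick v (suc _) = proj₁ (proj₂ (tokens (side (c v)) v refl))

  encode : Fin n → Fin 2 → Subset n × Fin 2
  encode v i = line (u₁ (pick v i)) (u₂ (pick v i)) , orientation (u₁ (pick v i)) (u₂ (pick v i))

  -- Line and bit give back the ordered pair, the colour of its first vertex gives the side, and
  -- `owner` then gives the vertex, whose two tokens are different pairs.
  encode-injective : ∀ v i v′ i′ → encode v i ≡ encode v′ i′ → v ≡ v′ × i ≡ i′
  encode-injective v i v′ i′ e = v≡v′ , index≡ v≡v′ i i′ u≡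
    where
    t = pick v i
    t′ = pick v′ i′
    u≡ : u₁ t ≡ u₁ t′ × u₂ t ≡ u₂ t′
    u≡ = [ (λ p → p) , (λ (p , q) → ⊥-elim (orientation-swap (d≡2⇒≢ (Token.dist-2 t))
             (trans (cong proj₂ e) (cong₂ orientation (sym q) (sym p))))) ]′ (same-pair t t′ (cong proj₁ e))
    b≡b′ : c v ≡ c v′
    b≡b′ = trans (sym (Token.colour t)) (trans (cong c (proj₁ u≡)) (Token.colour t′))
    v≡v′ : v ≡ v′
    v≡v′ = begin
      v                                     ≡⟨ sym (Token.owned t) ⟩
      owner (side (c v)) (u₁ t) (u₂ t)      ≡⟨ cong₂ (owner (side (c v))) (proj₁ u≡) (proj₂ u≡) ⟩
      owner (side (c v)) (u₁ t′) (u₂ t′)    ≡⟨ cong (λ b → owner (side b) (u₁ t′) (u₂ t′)) b≡b′ ⟩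
      owner (side (c v′)) (u₁ t′) (u₂ t′)   ≡⟨ Token.owned t′ ⟩
      v′                                    ∎
      where open ≡-Reasoning
    index≡ : ∀ {v v′} → v ≡ v′ → ∀ i i′ →
      u₁ (pick v i) ≡ u₁ (pick v′ i′) × u₂ (pick v i) ≡ u₂ (pick v′ i′) → i ≡ i′
    index≡ refl zero       zero       _ = refl
    index≡ refl (suc zero) (suc zero) _ = refl
    index≡ {v} refl zero       (suc zero) (p , q) = contradiction (p , q) (proj₂ (proj₂ (tokens (side (c v)) v refl)))
    index≡ {v} refl (suc zero) zero       (p , q) = contradiction (sym p , sym q) (proj₂ (proj₂ (tokens (side (c v)) v refl)))

  lines : List (Subset n)
  lines = deduplicate (≡-dec _≟ᵇ_) (map (λ p → interval G (proj₁ p) (proj₂ p))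
    (filter (λ p → dist G (proj₁ p) (proj₂ p) ≟ℕ 2) (cartesianProduct (allFin n) (allFin n))))

  line∈lines : ∀ {u v} → d u v ≡ 2 → line u v ∈ᴸ lines
  line∈lines {u} {v} uv = subst (_∈ᴸ lines) (sym (line≡interval u v))
    (∈-deduplicate⁺ (≡-dec _≟ᵇ_) (∈-map⁺ _ (∈-filter⁺ _
      (∈-cartesianProduct⁺ (∈-allFin u) (∈-allFin v)) (trans (sym (d≡dist u v)) uv))))

  count : n ≤ ℓ₂ G
  count = double-count lines encode (λ v i → line∈lines (Token.dist-2 (pick v i))) encode-injective

theorem2 : ∀ {n : ℕ} (G : Graph n) → TwoConnected G → Bipartite G → NoTwins G → n ≤ ℓ₂ G
theorem2 G (connected , 3≤n , noCut) (c , proper) noTwins = Counting.count G connected 3≤n noCut c proper noTwins
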